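{- Let $u$ be any element of $W=S_n$ and let $U=[e,u]_R$. Then the multiplication map $W/U\times U\to W$, $(x,y)\mapsto xy$, is surjective.
   Context: $S_n$ is the symmetric group with product $(uv)(i)=u(v(i))$, generated by adjacent transpositions. The length $\ell(w)$ is the number of inversions $\{(i,j): i<j,\ w(i)>w(j)\}$. Right weak order: $v\leq_R w$ iff $w=vz$ with $\ell(w)=\ell(v)+\ell(z)$; $[e,u]_R=\{v:v\leq_R u\}$. For $U\subseteq W$, $W/U=\{w\in W:\ell(wu)=\ell(w)+\ell(u)\ \forall u\in U\}$. -}

module Defs where

open import Data.Fin.Base using (Fin; _<_; _>_)
open import Data.Fin.Permutation using (Permutation′; _≈_; _∘ₚ_; _⟨$⟩ʳ_)
open import Data.Fin.Properties using (_<?_)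
open import Data.List.Base using (List; length; filter; cartesianProduct; allFin)
open import Data.Nat.Base using (ℕ; _+_)
open import Data.Product.Base using (∃; ∃-syntax; _×_; _,_)
open import Level using (Level; 0ℓ)
open import Relation.Binary.Core using (Rel)
open import Relation.Binary.PropositionalEquality.Core using (_≡_)
open import Relation.Nullary.Decidable using (_×-dec_)
open import Relation.Unary using (Pred; Decidable; _∈_)

private
  variable
    a b : Level
    n : ℕ

infixl 7 _·_
infix 4 _≤ᴿ_

-- The product of S_n, (u · v)(i) = u (v i); the library's _∘ₚ_ composes in
-- the opposite (diagrammatic) order.
_·_ : Permutation′ n → Permutation′ n → Permutation′ n
u · v = v ∘ₚ u

Inversion : Permutation′ n → Pred (Fin n × Fin n) 0ℓ
Inversion w (i , j) = i < j × (w ⟨$⟩ʳ i) > (w ⟨$⟩ʳ j)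

inversion? : (w : Permutation′ n) → Decidable (Inversion w)
inversion? w (i , j) = (i <? j) ×-dec ((w ⟨$⟩ʳ j) <? (w ⟨$⟩ʳ i))

-- The cartesian product lists every pair exactly once, so the length of the
-- filtered list is the cardinality of the inversion set.
inversions : Permutation′ n → List (Fin n × Fin n)
inversions {n} w = filter (inversion? w) (cartesianProduct (allFin n) (allFin n))

ℓ : Permutation′ n → ℕ
ℓ w = length (inversions w)

-- Elements of S_n are compared with _≈_ (pointwise equality), since a
-- permutation is represented by a record that also carries inverse proofs.
_≤ᴿ_ : Rel (Permutation′ n) 0ℓ
v ≤ᴿ w = ∃[ z ] (w ≈ v · z × ℓ w ≡ ℓ v + ℓ z)

[e,_]ᴿ : Permutation′ n → Pred (Permutation′ n) 0ℓ
[e, u ]ᴿ v = v ≤ᴿ u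

-- The generalized quotient W/U, with W = S_n.
W/_ : Pred (Permutation′ n) a → Pred (Permutation′ n) a
(W/ U) w = ∀ u → u ∈ U → ℓ (w · u) ≡ ℓ w + ℓ u

multiplication : (X : Pred (Permutation′ n) a) (Y : Pred (Permutation′ n) b) →
                 ∃ X × ∃ Y → Permutation′ n
multiplication X Y ((x , _) , (y , _)) = x · y

{-# OPTIONS --safe #-}
module Submission where

-- Since ℓ is subadditive, x ∈ W/[e,u] as soon as ℓ(xu) = ℓ(x) + ℓ(u).  Plot the
-- values a at the points (a, u⁻¹(a)) and the positions i at the points (i, w(i)).
-- Writing y = σ⁻¹ and x = wσ, the theorem asks for a bijection σ from the former
-- points to the latter such that, for a left of b, σ(a) is left of σ(b) if a is
-- below b, and σ(a) is below σ(b) if a is above b.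
--
-- Call σ valid if, for a left of b, either σ(a) is left of σ(b), or a is above b
-- and σ(a) is below σ(b); the identity is valid.  A valid σ that fails has a
-- bad pair: a above and left of b, and σ(a) above and left of σ(b).  Exchange
-- the images of an innermost bad pair.  Now a may lie to the right of images of
-- points above and right of a; repair this by exchanging a with the rightmost
-- such point as long as there is one, and then b symmetrically.  The result is
-- valid, and every exchange moves the higher of two points to the right, so
-- Σ u⁻¹(a) (n − σ(a)) decreases and the process ends.

open import Defs
open import Data.Fin.Permutation using (Permutation′; _≈_)
open import Data.Nat.Base using (ℕ)
open import Function.Definitions using (StrictlySurjective)

open import Data.Bool.Base using (if_then_else_)
open import Data.Empty using (⊥; ⊥-elim)
open import Data.Fin.Base as Fin using (Fin; zero; suc; toℕ)
open import Data.Fin.Induction using (spo-wellFounded; spo-noetherian)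
open import Data.Fin.Permutation as Perm using (_∘ₚ_; _⟨$⟩ʳ_; inverseˡ; inverseʳ; transpose)
import Data.Fin.Properties as Fin
open import Data.List.Base using (length; filter; cartesianProduct; tabulate; map; _++_)
open import Data.List.Properties using (filter-++; length-++)
open import Data.Nat.Base using (zero; suc; _+_; _*_; _∸_; _≤_; _<_; z≤n; s≤s)
open import Data.Nat.Induction using (<-wellFounded)
open import Data.Nat.Properties
  using (≤-antisym; ≤-refl; ≤-reflexive; ≤-trans; ≤-<-trans; <-asym; <-irrefl; <⇒≤; m≤m+n
        ; m≤n+m; m<m+n; m≤n⇒∃[o]m+o≡n; +-0-commutativeMonoid; +-assoc; +-cancelʳ-<
        ; +-cancelʳ-≤; +-identityʳ; +-mono-≤; +-monoʳ-<; ∸-monoʳ-<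
        ; module ≤-Reasoning)
open import Data.Nat.Tactic.RingSolver using (solve-∀)
open import Data.Product.Base using (∃; ∃-syntax; _×_; _,_; proj₁; proj₂)
open import Data.Sum.Base using (_⊎_; inj₁; inj₂; [_,_]′)
open import Data.Vec.Functional using (updateAt; removeAt)
open import Data.Vec.Functional.Properties using (updateAt-updates; updateAt-minimal)
open import Function.Base using (flip; _∘_; _on_; const; id; _$_)
open import Function.Bundles using (Injection)
open import Function.Properties.Inverse using (Inverse⇒Injection)
open import Induction.WellFounded using (Acc; acc)
open import Level using (0ℓ)
open import Relation.Binary.Core using (Rel)
open import Relation.Binary.Definitions using (Trichotomous; tri<; tri≈; tri>)
open import Relation.Binary.Structures using (IsStrictTotalOrder)
import Relation.Binary.Construct.Flip.EqAndOrd as Flip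
open import Relation.Binary.PropositionalEquality
open import Relation.Nullary using (¬_; Dec; yes; no; does; contradiction)
open import Relation.Nullary.Decidable using (_×-dec_; dec-true; dec-false)
open import Relation.Unary using (Pred; Decidable)

open import Algebra.Properties.CommutativeMonoid.Sum +-0-commutativeMonoid
  using (sum; sum-remove; ∑-distrib-+; ∑-comm; ∑-permute; sum-cong-≗)

private
  variable
    n : ℕ

indicator : ∀ {a} {A : Set a} → Dec A → ℕ
indicator d = if does d then 1 else 0

indicator-yes : ∀ {a} {A : Set a} (d : Dec A) → A → indicator d ≡ 1
indicator-yes (yes _) _ = refl
indicator-yes (no ¬a) a = contradiction a ¬a

indicator-no : ∀ {a} {A : Set a} (d : Dec A) → ¬ A → indicator d ≡ 0
indicator-no (yes a) ¬a = contradiction a ¬a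
indicator-no (no _)  _  = refl

indicator-cong : ∀ {a b} {A : Set a} {B : Set b} (d : Dec A) (e : Dec B) →
                 (A → B) → (B → A) → indicator d ≡ indicator e
indicator-cong (yes a) e f g = sym (indicator-yes e (f a))
indicator-cong (no ¬a) e f g = sym (indicator-no e (¬a ∘ g))

indicator-≤ : ∀ {a} {A : Set a} (d : Dec A) {m : ℕ} → (A → 1 ≤ m) → indicator d ≤ m
indicator-≤ (yes a) le = le a
indicator-≤ (no _)  le = z≤n

module _ {a b p} {A : Set a} {B : Set b} {P : Pred (A × B) p} (P? : Decidable P) where

  length-filter-row : ∀ x (f : Fin n → B) →
    length (filter P? (map (x ,_) (tabulate f))) ≡ sum (λ j → indicator (P? (x , f j)))
  length-filter-row {n = zero}  x f = refl
  length-filter-row {n = suc n} x f with P? (x , f zero)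
  ... | yes _ = cong suc (length-filter-row x (f ∘ suc))
  ... | no  _ = length-filter-row x (f ∘ suc)

  length-filter-cartesianProduct : ∀ {m} (f : Fin m → A) (g : Fin n → B) →
    length (filter P? (cartesianProduct (tabulate f) (tabulate g))) ≡
    sum (λ i → sum (λ j → indicator (P? (f i , g j))))
  length-filter-cartesianProduct {m = zero}  f g = refl
  length-filter-cartesianProduct {m = suc m} f g = begin
    length (filter P? (row ++ rest))                    ≡⟨ cong length (filter-++ P? row rest) ⟩
    length (filter P? row ++ filter P? rest)            ≡⟨ length-++ (filter P? row) ⟩
    length (filter P? row) + length (filter P? rest)    ≡⟨ cong₂ _+_ (length-filter-row (f zero) g) (length-filter-cartesianProduct (f ∘ suc) g) ⟩
    _ ∎
    where
    open ≡-Reasoning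
    row  = map (f zero ,_) (tabulate g)
    rest = cartesianProduct (tabulate (f ∘ suc)) (tabulate g)

∑∑ : (Fin n → Fin n → ℕ) → ℕ
∑∑ f = sum (λ i → sum (f i))

∑∑-cong : {f g : Fin n → Fin n → ℕ} → (∀ i j → f i j ≡ g i j) → ∑∑ f ≡ ∑∑ g
∑∑-cong eq = sum-cong-≗ (λ i → sum-cong-≗ (eq i))

sum-mono-≤ : {f g : Fin n → ℕ} → (∀ i → f i ≤ g i) → sum f ≤ sum g
sum-mono-≤ {n = zero}  _  = z≤n
sum-mono-≤ {n = suc n} le = +-mono-≤ (le zero) (sum-mono-≤ (le ∘ suc))

∑∑-mono-≤ : {f g : Fin n → Fin n → ℕ} → (∀ i j → f i j ≤ g i j) → ∑∑ f ≤ ∑∑ g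
∑∑-mono-≤ le = sum-mono-≤ (λ i → sum-mono-≤ (le i))

∑∑-distrib-+ : (f g : Fin n → Fin n → ℕ) → ∑∑ (λ i j → f i j + g i j) ≡ ∑∑ f + ∑∑ g
∑∑-distrib-+ f g = trans (sum-cong-≗ (λ i → ∑-distrib-+ (f i) (g i))) (∑-distrib-+ (sum ∘ f) (sum ∘ g))

∑∑-permute : (f : Fin n → Fin n → ℕ) (π : Permutation′ n) →
             ∑∑ f ≡ ∑∑ (λ i j → f (π ⟨$⟩ʳ i) (π ⟨$⟩ʳ j))
∑∑-permute f π = trans (∑-permute (sum ∘ f) π) (sum-cong-≗ (λ i → ∑-permute (f (π ⟨$⟩ʳ i)) π))

ℓ≡∑∑ : (w : Permutation′ n) → ℓ w ≡ ∑∑ (λ i j → indicator (inversion? w (i , j)))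
ℓ≡∑∑ w = length-filter-cartesianProduct (inversion? w) (λ i → i) (λ j → j)

ℓ-cong : {v w : Permutation′ n} → v ≈ w → ℓ v ≡ ℓ w
ℓ-cong {v = v} {w} v≈w = begin
  ℓ v   ≡⟨ ℓ≡∑∑ v ⟩
  _     ≡⟨ ∑∑-cong (λ i j → indicator-cong (inversion? v (i , j)) (inversion? w (i , j))
             (λ (i<j , inv) → i<j , subst₂ Fin._<_ (v≈w j) (v≈w i) inv)
             (λ (i<j , inv) → i<j , subst₂ Fin._<_ (sym (v≈w j)) (sym (v≈w i)) inv)) ⟩
  _     ≡⟨ ℓ≡∑∑ w ⟨
  ℓ w   ∎
  where open ≡-Reasoning

-- The length of a product.

-- The inversions of x are the images under z of the pairs i < j counted by kept
-- (made by x) and by lost (inversions of z undone by x).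
module _ (x z : Permutation′ n) where

  private
    X Z : Fin n → Fin n
    X = x ⟨$⟩ʳ_
    Z = z ⟨$⟩ʳ_

    moved? : ∀ i j → Dec (Z i Fin.< Z j × X (Z j) Fin.< X (Z i))
    moved? i j = (Z i Fin.<? Z j) ×-dec (X (Z j) Fin.<? X (Z i))

    kept? : ∀ i j → Dec (i Fin.< j × Z i Fin.< Z j × X (Z j) Fin.< X (Z i))
    kept? i j = (i Fin.<? j) ×-dec moved? i j

    lost? : ∀ i j → Dec (i Fin.< j × Z j Fin.< Z i × X (Z i) Fin.< X (Z j))
    lost? i j = (i Fin.<? j) ×-dec moved? j i

    inv-z inv-xz moved kept lost : Fin n → Fin n → ℕ
    inv-z  i j = indicator (inversion? z (i , j))
    inv-xz i j = indicator (inversion? (x · z) (i , j))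
    moved  i j = indicator (moved? i j)
    kept   i j = indicator (kept? i j)
    lost   i j = indicator (lost? i j)

    -- `moved` orders a pair by its images under `z`, `kept` and `lost` order it by its indices;
    -- comparing `i` with `j` decides which of the two counts it.
    moved≡kept+lost : ∀ i j → moved i j ≡ kept i j + lost j i
    moved≡kept+lost i j with Fin.<-cmp i j
    ... | tri< i<j _ j≮i = trans (sym (+-identityʳ _)) (cong₂ _+_
            (indicator-cong (moved? i j) (kept? i j) (i<j ,_) proj₂)
            (sym (indicator-no (lost? j i) (j≮i ∘ proj₁))))
    ... | tri> i≮j _ j<i = cong₂ _+_
            (sym (indicator-no (kept? i j) (i≮j ∘ proj₁)))
            (indicator-cong (moved? i j) (lost? j i) (j<i ,_) proj₂)
    ... | tri≈ i≮i refl _ = trans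
            (indicator-no (moved? i i) (λ (lt , _) → Fin.<-irrefl refl lt))
            (sym (cong₂ _+_ (indicator-no (kept? i i) (i≮i ∘ proj₁))
                            (indicator-no (lost? i i) (i≮i ∘ proj₁))))

    ℓx≡ : ℓ x ≡ ∑∑ (λ i j → kept i j + lost i j)
    ℓx≡ = begin
      ℓ x                                ≡⟨ ℓ≡∑∑ x ⟩
      _                                  ≡⟨ ∑∑-permute (λ i j → indicator (inversion? x (i , j))) z ⟩
      ∑∑ moved                           ≡⟨ ∑∑-cong moved≡kept+lost ⟩
      _                                  ≡⟨ ∑∑-distrib-+ kept (λ i j → lost j i) ⟩
      ∑∑ kept + ∑∑ (λ i j → lost j i)    ≡⟨ cong (∑∑ kept +_) (∑-comm (λ i j → lost j i)) ⟩
      ∑∑ kept + ∑∑ lost                  ≡⟨ ∑∑-distrib-+ kept lost ⟨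
      _                                  ∎
      where open ≡-Reasoning

    ℓx+ℓz≡ : ℓ x + ℓ z ≡ ∑∑ (λ i j → kept i j + lost i j + inv-z i j)
    ℓx+ℓz≡ = trans (cong₂ _+_ ℓx≡ (ℓ≡∑∑ z)) (sym (∑∑-distrib-+ (λ i j → kept i j + lost i j) inv-z))

    -- An inversion of the product is made by `x` if `z` keeps the pair in order, and otherwise it
    -- is already an inversion of `z`.
    inv-xz≤ : ∀ i j → inv-xz i j ≤ kept i j + lost i j + inv-z i j
    inv-xz≤ i j = indicator-≤ (inversion? (x · z) (i , j)) go
      where
      go : Inversion (x · z) (i , j) → 1 ≤ kept i j + lost i j + inv-z i j
      go (i<j , inv) with Fin.<-cmp (Z i) (Z j)
      ... | tri< lt _ _ = ≤-trans
              (≤-reflexive (sym (indicator-yes (kept? i j) (i<j , lt , inv))))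
              (≤-trans (m≤m+n (kept i j) (lost i j)) (m≤m+n _ (inv-z i j)))
      ... | tri> _ _ gt = ≤-trans
              (≤-reflexive (sym (indicator-yes (inversion? z (i , j)) (i<j , gt))))
              (m≤n+m _ (kept i j + lost i j))
      ... | tri≈ _ eq _ = contradiction inv (Fin.<-irrefl (cong X (sym eq)))

  ℓ-subadditive : ℓ (x · z) ≤ ℓ x + ℓ z
  ℓ-subadditive = begin
    ℓ (x · z)   ≡⟨ ℓ≡∑∑ (x · z) ⟩
    ∑∑ inv-xz   ≤⟨ ∑∑-mono-≤ inv-xz≤ ⟩
    _           ≡⟨ ℓx+ℓz≡ ⟨
    ℓ x + ℓ z   ∎
    where open ≤-Reasoning

  -- By hypothesis `x` undoes no inversion of `z`, so `lost` vanishes. The pairs counted by `kept`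
  -- and by `inv-z` are disjoint, and both kinds are inversions of `x · z`.
  ℓ-additive : (∀ {i j} → i Fin.< j → Z j Fin.< Z i → X (Z j) Fin.< X (Z i)) →
               ℓ (x · z) ≡ ℓ x + ℓ z
  ℓ-additive keeps = ≤-antisym ℓ-subadditive $ begin
    ℓ x + ℓ z   ≡⟨ ℓx+ℓz≡ ⟩
    _           ≤⟨ ∑∑-mono-≤ ≤inv-xz ⟩
    ∑∑ inv-xz   ≡⟨ ℓ≡∑∑ (x · z) ⟨
    ℓ (x · z)   ∎
    where
    open ≤-Reasoning
    1≤inv-xz : ∀ {i j} → Inversion (x · z) (i , j) → 1 ≤ inv-xz i j
    1≤inv-xz {i} {j} inv = ≤-reflexive (sym (indicator-yes (inversion? (x · z) (i , j)) inv))

    ≤inv-xz : ∀ i j → kept i j + lost i j + inv-z i j ≤ inv-xz i j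
    ≤inv-xz i j with Fin.<-cmp (Z i) (Z j)
    ... | tri< lt _ gt≯ = begin
      kept i j + lost i j + inv-z i j ≡⟨ cong₂ (λ a b → kept i j + a + b)
                                           (indicator-no (lost? i j) (gt≯ ∘ proj₁ ∘ proj₂))
                                           (indicator-no (inversion? z (i , j)) (gt≯ ∘ proj₂)) ⟩
      kept i j + 0 + 0                ≡⟨ trans (+-identityʳ _) (+-identityʳ _) ⟩
      kept i j                        ≤⟨ indicator-≤ (kept? i j) (λ (i<j , _ , inv) → 1≤inv-xz (i<j , inv)) ⟩
      inv-xz i j                      ∎
    ... | tri≈ lt≮ _ gt≯ = begin
      kept i j + lost i j + inv-z i j ≡⟨ cong₂ _+_ (cong₂ _+_
                                           (indicator-no (kept? i j) (lt≮ ∘ proj₁ ∘ proj₂))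
                                           (indicator-no (lost? i j) (gt≯ ∘ proj₁ ∘ proj₂)))
                                           (indicator-no (inversion? z (i , j)) (gt≯ ∘ proj₂)) ⟩
      0                               ≤⟨ z≤n ⟩
      inv-xz i j                      ∎
    ... | tri> lt≮ _ gt = begin
      kept i j + lost i j + inv-z i j ≡⟨ cong (_+ inv-z i j) (cong₂ _+_
                                           (indicator-no (kept? i j) (lt≮ ∘ proj₁ ∘ proj₂))
                                           (indicator-no (lost? i j) (λ (i<j , _ , lt) → Fin.<-asym lt (keeps i<j gt)))) ⟩
      inv-z i j                       ≤⟨ indicator-≤ (inversion? z (i , j)) (λ (i<j , inv) → 1≤inv-xz (i<j , keeps i<j inv)) ⟩
      inv-xz i j                      ∎

-- Exchanging images and choosing extremal points.

abstract
  swap : Fin n → Fin n → Permutation′ n → Permutation′ n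
  swap a b σ = transpose a b ∘ₚ σ

  swap-fst : ∀ a b (σ : Permutation′ n) → swap a b σ ⟨$⟩ʳ a ≡ σ ⟨$⟩ʳ b
  swap-fst a b σ rewrite dec-true (a Fin.≟ a) refl = refl

  swap-snd : ∀ a b (σ : Permutation′ n) → swap a b σ ⟨$⟩ʳ b ≡ σ ⟨$⟩ʳ a
  swap-snd a b σ with b Fin.≟ a
  ... | yes refl = refl
  ... | no  _ rewrite dec-true (b Fin.≟ b) refl = refl

  swap-other : ∀ {a b c} (σ : Permutation′ n) → c ≢ a → c ≢ b →
               swap a b σ ⟨$⟩ʳ c ≡ σ ⟨$⟩ʳ c
  swap-other {a = a} {b} {c} σ c≢a c≢b
    rewrite dec-false (c Fin.≟ a) c≢a | dec-false (c Fin.≟ b) c≢b = refl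

-- Climbing from the given witness to larger ones stops, since a strict order on a finite set is
-- Noetherian.
greatest : ∀ {p} {_⊏_ : Rel (Fin n) 0ℓ} → IsStrictTotalOrder _≡_ _⊏_ →
           {P : Pred (Fin n) p} → Decidable P → ∃ P →
           ∃[ a ] P a × (∀ {b} → P b → ¬ a ⊏ b)
greatest {_⊏_ = _⊏_} sto {P} P? (a , Pa) = go a Pa (spo-noetherian isStrictPartialOrder a)
  where
  open IsStrictTotalOrder sto
  go : ∀ a → P a → Acc (flip _⊏_) a → ∃[ a ] P a × (∀ {b} → P b → ¬ a ⊏ b)
  go a Pa (acc rs) with Fin.any? (λ b → P? b ×-dec (a <? b))
  ... | yes (b , Pb , a<b) = go b Pb (rs a<b)
  ... | no  none           = a , Pa , λ Pb a<b → none (_ , Pb , a<b)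

-- The four orders and their duality.

-- <x and <h order the values by the two coordinates of the points (a, u⁻¹(a)),
-- and <p and <f the positions by those of (i, w(i)).
record Orders (n : ℕ) : Set₁ where
  infix 4 _<x_ _<h_ _<p_ _<f_
  field
    _<x_ _<h_ _<p_ _<f_ : Rel (Fin n) 0ℓ
    x-isSTO : IsStrictTotalOrder _≡_ _<x_
    h-isSTO : IsStrictTotalOrder _≡_ _<h_
    p-isSTO : IsStrictTotalOrder _≡_ _<p_
    f-isSTO : IsStrictTotalOrder _≡_ _<f_

  module x = IsStrictTotalOrder x-isSTO
  module h = IsStrictTotalOrder h-isSTO
  module p = IsStrictTotalOrder p-isSTO
  module f = IsStrictTotalOrder f-isSTO

  Compatible : Permutation′ n → Rel (Fin n) 0ℓ
  Compatible σ a b = b <h a × (σ ⟨$⟩ʳ a) <f (σ ⟨$⟩ʳ b)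

-- Reversing all four orders turns compatibility of `a`, `b` into that of `b`, `a`, so the slide of
-- the lower exchanged point is an instance of the slide of the higher one.
dual : Orders n → Orders n
dual O = record
  { _<x_ = flip _<x_ ; x-isSTO = Flip.isStrictTotalOrder x-isSTO
  ; _<h_ = flip _<h_ ; h-isSTO = Flip.isStrictTotalOrder h-isSTO
  ; _<p_ = flip _<p_ ; p-isSTO = Flip.isStrictTotalOrder p-isSTO
  ; _<f_ = flip _<f_ ; f-isSTO = Flip.isStrictTotalOrder f-isSTO
  } where open Orders O

-- The higher point has its image on the left and is moved to the right. For `dual O` this is the
-- same condition with the two points interchanged.
Decreases : (Permutation′ n → ℕ) → Orders n → Set
Decreases μ O = ∀ σ {a b} → a <h b → (σ ⟨$⟩ʳ b) <p (σ ⟨$⟩ʳ a) → μ (swap a b σ) < μ σ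
  where open Orders O

-- Sliding one point of an exchanged pair.

-- Exempt holds the violations that the slide of r leaves for the slide of the
-- other exchanged point, and Z contains the positions that it may use.
module Sliding (O : Orders n) {μ : Permutation′ n → ℕ} (μ-decreases : Decreases μ O)
               (r : Fin n) (Exempt : Rel (Fin n) 0ℓ)
               (exempt-below : ∀ {a b} → Exempt a b → Orders._<h_ O b r)
               (Z : Pred (Fin n) 0ℓ) where

  open Orders O

  Blocking : Permutation′ n → Pred (Fin n) 0ℓ
  Blocking σ c = r <x c × r <h c × (σ ⟨$⟩ʳ c) <p (σ ⟨$⟩ʳ r)

  blocking? : ∀ σ → Decidable (Blocking σ)
  blocking? σ c = (r x.<? c) ×-dec ((r h.<? c) ×-dec ((σ ⟨$⟩ʳ c) p.<? (σ ⟨$⟩ʳ r)))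

  -- t is the point that occupied the position of r just before r did; tenant is
  -- what remains of the validity of σ before that exchange.
  record Slidable (σ : Permutation′ n) (t : Fin n) : Set where
    field
      compatible : ∀ {a b} → a <x b → (σ ⟨$⟩ʳ b) <p (σ ⟨$⟩ʳ a) →
                   Compatible σ a b ⊎ (a ≡ r × r <h b) ⊎ Exempt a b
      blocking-<t : ∀ {c} → Blocking σ c → c <x t
      tenant      : ∀ {c} → c <x t → (σ ⟨$⟩ʳ r) <p (σ ⟨$⟩ʳ c) → (σ ⟨$⟩ʳ c) <f (σ ⟨$⟩ʳ r)
      blocking∈Z  : ∀ {c} → Blocking σ c → Z (σ ⟨$⟩ʳ c)
      r∈Z         : Z (σ ⟨$⟩ʳ r)
      Z-below     : ∀ {c z} → r <x c → c <h r → (σ ⟨$⟩ʳ c) <p (σ ⟨$⟩ʳ r) →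
                    Z z → z <f (σ ⟨$⟩ʳ c)

  module Step {σ t} (slidable : Slidable σ t) {e} (e-blocking : Blocking σ e)
              (e-rightmost : ∀ {c} → Blocking σ c → ¬ e <x c) where

    open Slidable slidable

    r<e : r <x e
    r<e = proj₁ e-blocking

    r<ₕe : r <h e
    r<ₕe = proj₁ (proj₂ e-blocking)

    σe<σr : (σ ⟨$⟩ʳ e) <p (σ ⟨$⟩ʳ r)
    σe<σr = proj₂ (proj₂ e-blocking)

    τ : Permutation′ n
    τ = swap r e σ

    τr : τ ⟨$⟩ʳ r ≡ σ ⟨$⟩ʳ e
    τr = swap-fst r e σ

    τe : τ ⟨$⟩ʳ e ≡ σ ⟨$⟩ʳ r
    τe = swap-snd r e σ

    data Position (c : Fin n) : Set where
      at-r : c ≡ r → Position c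
      at-e : c ≡ e → Position c
      at-c : c ≢ r → c ≢ e → τ ⟨$⟩ʳ c ≡ σ ⟨$⟩ʳ c → Position c

    position : ∀ c → Position c
    position c with c Fin.≟ r | c Fin.≟ e
    ... | yes c≡r | _       = at-r c≡r
    ... | no _    | yes c≡e = at-e c≡e
    ... | no c≢r  | no c≢e  = at-c c≢r c≢e (swap-other σ c≢r c≢e)

    -- The second point of an exempt pair is below `r`, whereas `e` is above it; so no exception
    -- applies to `c` and `e`.
    left-of-e : ∀ {c} → c <x e → (σ ⟨$⟩ʳ e) <p (σ ⟨$⟩ʳ c) → c ≢ r → Compatible σ c e
    left-of-e c<e e<c c≢r with compatible c<e e<c
    ... | inj₁ ok                  = ok
    ... | inj₂ (inj₁ (c≡r , _))    = contradiction c≡r c≢r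
    ... | inj₂ (inj₂ exempt)       = contradiction r<ₕe (h.asym (exempt-below exempt))

    -- The image of `r` has moved left, so no new point blocks; `e` itself now has its image to the
    -- right, and the other blocking points are left of `e` by its choice.
    blocking-τ : ∀ {c} → Blocking τ c → Blocking σ c × c <x e × τ ⟨$⟩ʳ c ≡ σ ⟨$⟩ʳ c
    blocking-τ {c} (r<c , r<ₕc , τc<τr) with position c
    ... | at-r refl = contradiction r<c (x.irrefl refl)
    ... | at-e refl = contradiction (subst₂ _<p_ τe τr τc<τr) (p.asym σe<σr)
    ... | at-c _ c≢e eq with blk ← (r<c , r<ₕc , p.trans (subst₂ _<p_ eq τr τc<τr) σe<σr) | x.compare c e
    ...   | tri< c<e _ _ = blk , c<e , eq
    ...   | tri≈ _ c≡e _ = contradiction c≡e c≢e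
    ...   | tri> _ _ e<c = contradiction e<c (e-rightmost blk)

    Z-below-e : ∀ {c z} → r <x c → c <h r → (σ ⟨$⟩ʳ c) <p (σ ⟨$⟩ʳ e) → Z z → z <f (σ ⟨$⟩ʳ c)
    Z-below-e r<c c<ₕr c<e = Z-below r<c c<ₕr (p.trans c<e σe<σr)

    compatible-τ : ∀ {a b} → a <x b → (τ ⟨$⟩ʳ b) <p (τ ⟨$⟩ʳ a) →
                   Compatible τ a b ⊎ (a ≡ r × r <h b) ⊎ Exempt a b
    compatible-τ {a} {b} a<b τb<τa with position a | position b
    ... | at-r refl | at-r refl = contradiction a<b (x.irrefl refl)
    ... | at-r refl | at-e refl = inj₂ (inj₁ (refl , r<ₕe))
    ... | at-r refl | at-c b≢r _ eq with h.compare r b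
    ...   | tri< r<ₕb _ _ = inj₂ (inj₁ (refl , r<ₕb))
    ...   | tri≈ _ r≡b _ = contradiction (sym r≡b) b≢r
    -- The new position of `r` is in `Z`, and `Z` lies below the image of such a lower point in
    -- `<f`.
    ...   | tri> _ _ b<ₕr rewrite τr | eq = inj₁ (b<ₕr , Z-below-e a<b b<ₕr τb<τa (blocking∈Z e-blocking))
    compatible-τ a<b τb<τa | at-e refl | at-r refl = contradiction r<e (x.asym a<b)
    compatible-τ a<b τb<τa | at-e refl | at-e refl = contradiction a<b (x.irrefl refl)
    compatible-τ {b = b} a<b τb<τa | at-e refl | at-c b≢r _ eq rewrite τe | eq with h.compare r b
    -- Such a `b` would have blocked `r` from further right than `e`.
    ...   | tri< r<ₕb _ _ = contradiction a<b (e-rightmost (x.trans r<e a<b , r<ₕb , τb<τa))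
    ...   | tri≈ _ r≡b _ = contradiction (sym r≡b) b≢r
    ...   | tri> _ _ b<ₕr = inj₁ (h.trans b<ₕr r<ₕe , Z-below (x.trans r<e a<b) b<ₕr τb<τa r∈Z)
    compatible-τ a<b τb<τa | at-c a≢r _ eq | at-r refl rewrite eq | τr
      with e<ₕa , σa<σe ← left-of-e (x.trans a<b r<e) τb<τa a≢r = inj₁ (h.trans r<ₕe e<ₕa , σa<σe)
    -- `e` inherits the position of `r`. As `e` is left of `t`, so is the point considered, and what
    -- held for the former occupant `t` now serves `e`.
    compatible-τ a<b τb<τa | at-c a≢r _ eq | at-e refl rewrite eq | τe =
      inj₁ ( proj₁ (left-of-e a<b (p.trans σe<σr τb<τa) a≢r)
           , tenant (x.trans a<b (blocking-<t e-blocking)) τb<τa)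
    compatible-τ a<b τb<τa | at-c a≢r _ eqa | at-c _ _ eqb rewrite eqa | eqb = compatible a<b τb<τa

    -- The roles shift by one: `e` has just left the position that `r` now holds, so it replaces
    -- `t`, and `left-of-e` supplies `tenant`.
    slidable-τ : Slidable τ e
    slidable-τ = record
      { compatible  = compatible-τ
      ; blocking-<t = λ blk → proj₁ (proj₂ (blocking-τ blk))
      ; tenant      = tenant-τ
      ; blocking∈Z  = λ blk → let blk′ , _ , eq = blocking-τ blk in subst Z (sym eq) (blocking∈Z blk′)
      ; r∈Z         = subst Z (sym τr) (blocking∈Z e-blocking)
      ; Z-below     = Z-below-τ
      }
      where
      tenant-τ : ∀ {c} → c <x e → (τ ⟨$⟩ʳ r) <p (τ ⟨$⟩ʳ c) → (τ ⟨$⟩ʳ c) <f (τ ⟨$⟩ʳ r)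
      tenant-τ {c} c<e τr<τc with position c
      ... | at-r refl = contradiction τr<τc (p.irrefl refl)
      ... | at-e refl = contradiction c<e (x.irrefl refl)
      ... | at-c c≢r _ eq rewrite τr | eq = proj₂ (left-of-e c<e τr<τc c≢r)

      Z-below-τ : ∀ {c z} → r <x c → c <h r → (τ ⟨$⟩ʳ c) <p (τ ⟨$⟩ʳ r) → Z z → z <f (τ ⟨$⟩ʳ c)
      Z-below-τ {c} r<c c<ₕr τc<τr z∈Z with position c
      ... | at-r refl = contradiction r<c (x.irrefl refl)
      ... | at-e refl = contradiction r<ₕe (h.asym c<ₕr)
      ... | at-c _ _ eq rewrite τr | eq = Z-below-e r<c c<ₕr τc<τr z∈Z

    moved-τ : ∀ c → τ ⟨$⟩ʳ c ≡ σ ⟨$⟩ʳ c ⊎ (¬ c <h r × Z (τ ⟨$⟩ʳ c))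
    moved-τ c with position c
    ... | at-r refl   = inj₂ (h.irrefl refl , subst Z (sym τr) (blocking∈Z e-blocking))
    ... | at-e refl   = inj₂ (h.asym r<ₕe , subst Z (sym τe) r∈Z)
    ... | at-c _ _ eq = inj₁ eq

  record Slid (σ τ : Permutation′ n) : Set where
    field
      μ-≤        : μ τ ≤ μ σ
      compatible : ∀ {a b} → a <x b → (τ ⟨$⟩ʳ b) <p (τ ⟨$⟩ʳ a) → Compatible τ a b ⊎ Exempt a b
      moved      : ∀ c → τ ⟨$⟩ʳ c ≡ σ ⟨$⟩ʳ c ⊎ (¬ c <h r × Z (τ ⟨$⟩ʳ c))

  -- Each exchange moves the image of `r` strictly left, which gives termination.
  slide : ∀ {σ t} → Slidable σ t → ∃ (Slid σ)
  slide {σ} slidable = go slidable (spo-wellFounded p.isStrictPartialOrder _)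
    where
    go : ∀ {σ t} → Slidable σ t → Acc _<p_ (σ ⟨$⟩ʳ r) → ∃ (Slid σ)
    go {σ} slidable (acc rs) with Fin.any? (blocking? σ)
    ... | no none = σ , record
      { μ-≤        = ≤-refl
      ; compatible = λ a<b σb<σa → case a<b σb<σa (Slidable.compatible slidable a<b σb<σa)
      ; moved      = λ _ → inj₁ refl
      }
      where
      case : ∀ {a b} → a <x b → (σ ⟨$⟩ʳ b) <p (σ ⟨$⟩ʳ a) →
             Compatible σ a b ⊎ (a ≡ r × r <h b) ⊎ Exempt a b → Compatible σ a b ⊎ Exempt a b
      case a<b σb<σa (inj₁ ok)                    = inj₁ ok
      -- A remaining violation between `r` and a higher point would make that point blocking.
      case a<b σb<σa (inj₂ (inj₁ (refl , r<ₕb)))  = contradiction (_ , a<b , r<ₕb , σb<σa) none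
      case a<b σb<σa (inj₂ (inj₂ exempt))         = inj₂ exempt
    ... | yes some with e , e-blocking , e-rightmost ← greatest x-isSTO (blocking? σ) some =
      let open Step slidable e-blocking (λ {c} → e-rightmost {c})
          ρ , slid = go slidable-τ (rs (subst (_<p (σ ⟨$⟩ʳ r)) (sym τr) σe<σr))
          moved-ρ : ∀ c → ρ ⟨$⟩ʳ c ≡ σ ⟨$⟩ʳ c ⊎ (¬ c <h r × Z (ρ ⟨$⟩ʳ c))
          moved-ρ c = [ (λ ρc≡τc → [ (λ τc≡σc → inj₁ (trans ρc≡τc τc≡σc))
                                 , (λ (c≮r , z) → inj₂ (c≮r , subst Z (sym ρc≡τc) z)) ]′ (moved-τ c))
                    , inj₂ ]′ (Slid.moved slid c)
      in ρ , record
      { μ-≤        = ≤-trans (Slid.μ-≤ slid) (<⇒≤ (μ-decreases σ r<ₕe σe<σr))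
      ; compatible = Slid.compatible slid
      ; moved      = moved-ρ
      }

-- Removing bad pairs from a valid bijection.

⟨$⟩ʳ-injective : (σ : Permutation′ n) {a b : Fin n} → σ ⟨$⟩ʳ a ≡ σ ⟨$⟩ʳ b → a ≡ b
⟨$⟩ʳ-injective σ = Injection.injective (Inverse⇒Injection σ)

on-isSTO : (σ : Permutation′ n) {_⊏_ : Rel (Fin n) 0ℓ} →
           IsStrictTotalOrder _≡_ _⊏_ → IsStrictTotalOrder _≡_ (_⊏_ on (σ ⟨$⟩ʳ_))
on-isSTO σ {_⊏_} sto = record
  { isStrictPartialOrder = record
    { isEquivalence = isEquivalence
    ; irrefl        = λ { refl → S.irrefl refl }
    ; trans         = S.trans
    ; <-resp-≈      = (λ { refl → id }) , (λ { refl → id })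
    }
  ; compare = compare
  }
  where
  module S = IsStrictTotalOrder sto
  compare : Trichotomous _≡_ (_⊏_ on (σ ⟨$⟩ʳ_))
  compare a b with S.compare (σ ⟨$⟩ʳ a) (σ ⟨$⟩ʳ b)
  ... | tri< lt ne gt = tri< lt (ne ∘ cong (σ ⟨$⟩ʳ_)) gt
  ... | tri≈ lt eq gt = tri≈ lt (⟨$⟩ʳ-injective σ eq) gt
  ... | tri> lt ne gt = tri> lt (ne ∘ cong (σ ⟨$⟩ʳ_)) gt

module Improvement (O : Orders n) {μ : Permutation′ n → ℕ}
                   (μ-decreases : Decreases μ O) (μ-decreasesᵈ : Decreases μ (dual O)) where

  open Orders O

  Valid : Permutation′ n → Set
  Valid σ = ∀ {a b} → a <x b → (σ ⟨$⟩ʳ b) <p (σ ⟨$⟩ʳ a) → Compatible σ a b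

  Bad : Permutation′ n → Fin n → Pred (Fin n) 0ℓ
  Bad σ a b = a <x b × b <h a × (σ ⟨$⟩ʳ a) <p (σ ⟨$⟩ʳ b) × (σ ⟨$⟩ʳ b) <f (σ ⟨$⟩ʳ a)

  bad? : ∀ σ a → Decidable (Bad σ a)
  bad? σ a b = (a x.<? b) ×-dec ((b h.<? a) ×-dec
               (((σ ⟨$⟩ʳ a) p.<? (σ ⟨$⟩ʳ b)) ×-dec ((σ ⟨$⟩ʳ b) f.<? (σ ⟨$⟩ʳ a))))

  record Innermost (σ : Permutation′ n) (a b : Fin n) : Set where
    field
      bad       : Bad σ a b
      fst-inner : ∀ {c} → a <x c → c <h a → (σ ⟨$⟩ʳ a) <p (σ ⟨$⟩ʳ c) → (σ ⟨$⟩ʳ c) <p (σ ⟨$⟩ʳ b) →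
                  (σ ⟨$⟩ʳ a) <f (σ ⟨$⟩ʳ c)
      snd-inner : ∀ {c} → c <x b → b <h c → (σ ⟨$⟩ʳ a) <p (σ ⟨$⟩ʳ c) → (σ ⟨$⟩ʳ c) <p (σ ⟨$⟩ʳ b) →
                  (σ ⟨$⟩ʳ c) <f (σ ⟨$⟩ʳ b)

  -- Take `a` with rightmost image among the first members of bad pairs, then its partner `b` with
  -- leftmost image. A failure of `fst-inner` would give `a` an earlier partner; one of `snd-inner`
  -- would give `b` a later one.
  innermost : ∀ {σ} → ∃ (∃ ∘ Bad σ) → ∃[ a ] ∃[ b ] Innermost σ a b
  innermost {σ} some
    with a , bad-a , a-latest ← greatest (on-isSTO σ p-isSTO) (λ a → Fin.any? (bad? σ a)) some
    with b , bad , b-earliest ← greatest (Flip.isStrictTotalOrder (on-isSTO σ p-isSTO)) (bad? σ a) bad-a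
    = a , b , record
    { bad       = bad
    ; fst-inner = fst-inner
    ; snd-inner = snd-inner
    }
    where
    fst-inner : ∀ {c} → a <x c → c <h a → (σ ⟨$⟩ʳ a) <p (σ ⟨$⟩ʳ c) → (σ ⟨$⟩ʳ c) <p (σ ⟨$⟩ʳ b) →
                (σ ⟨$⟩ʳ a) <f (σ ⟨$⟩ʳ c)
    fst-inner {c} a<c c<ₕa σa<σc σc<σb with f.compare (σ ⟨$⟩ʳ a) (σ ⟨$⟩ʳ c)
    ... | tri< lt _ _ = lt
    ... | tri≈ _ eq _ = contradiction σa<σc (p.irrefl eq)
    ... | tri> _ _ gt = contradiction σc<σb (b-earliest (a<c , c<ₕa , σa<σc , gt))
    snd-inner : ∀ {c} → c <x b → b <h c → (σ ⟨$⟩ʳ a) <p (σ ⟨$⟩ʳ c) → (σ ⟨$⟩ʳ c) <p (σ ⟨$⟩ʳ b) →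
                (σ ⟨$⟩ʳ c) <f (σ ⟨$⟩ʳ b)
    snd-inner {c} c<b b<ₕc σa<σc σc<σb with f.compare (σ ⟨$⟩ʳ c) (σ ⟨$⟩ʳ b)
    ... | tri< lt _ _ = lt
    ... | tri≈ _ eq _ = contradiction σc<σb (p.irrefl eq)
    ... | tri> _ _ gt = contradiction σa<σc (a-latest (b , c<b , b<ₕc , σc<σb , gt))

  module Exchange {σ a b} (valid : Valid σ) (inner : Innermost σ a b) where

    open Innermost inner

    a<b : a <x b
    a<b = proj₁ bad

    b<ₕa : b <h a
    b<ₕa = proj₁ (proj₂ bad)

    α β : Fin n
    α = σ ⟨$⟩ʳ a
    β = σ ⟨$⟩ʳ b

    α<β : α <p β
    α<β = proj₁ (proj₂ (proj₂ bad))

    β<ᶠα : β <f α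
    β<ᶠα = proj₂ (proj₂ (proj₂ bad))

    τ : Permutation′ n
    τ = swap b a σ

    τa : τ ⟨$⟩ʳ a ≡ β
    τa = swap-snd b a σ

    τb : τ ⟨$⟩ʳ b ≡ α
    τb = swap-fst b a σ

    data Position (c : Fin n) : Set where
      at-a : c ≡ a → Position c
      at-b : c ≡ b → Position c
      at-c : c ≢ a → c ≢ b → τ ⟨$⟩ʳ c ≡ σ ⟨$⟩ʳ c → Position c

    position : ∀ c → Position c
    position c with c Fin.≟ a | c Fin.≟ b
    ... | yes c≡a | _       = at-a c≡a
    ... | no _    | yes c≡b = at-b c≡b
    ... | no c≢a  | no c≢b  = at-c c≢a c≢b (swap-other σ c≢b c≢a)

    -- An image between `α` and `β` is handled by innermostness, one left of `α` by validity.
    -- `below-β` is the mirror image.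
    above-α : ∀ {c} → a <x c → c <h a → c ≢ a → (σ ⟨$⟩ʳ c) <p β → α <f (σ ⟨$⟩ʳ c)
    above-α {c} a<c c<ₕa c≢a σc<β with p.compare α (σ ⟨$⟩ʳ c)
    ... | tri< α<σc _ _ = fst-inner a<c c<ₕa α<σc σc<β
    ... | tri≈ _ eq _   = contradiction (sym (⟨$⟩ʳ-injective σ eq)) c≢a
    ... | tri> _ _ σc<α = proj₂ (valid a<c σc<α)

    below-β : ∀ {c} → c <x b → b <h c → c ≢ b → α <p (σ ⟨$⟩ʳ c) → (σ ⟨$⟩ʳ c) <f β
    below-β {c} c<b b<ₕc c≢b α<σc with p.compare (σ ⟨$⟩ʳ c) β
    ... | tri< σc<β _ _ = snd-inner c<b b<ₕc α<σc σc<β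
    ... | tri≈ _ eq _   = contradiction (⟨$⟩ʳ-injective σ eq) c≢b
    ... | tri> _ _ β<σc = proj₂ (valid c<b β<σc)

    Exempt : Rel (Fin n) 0ℓ
    Exempt c d = d ≡ b × c <h b

    -- The exchange leaves two kinds of violation: `a` with a higher point, repaired by sliding `a`,
    -- and a lower point with `b`, repaired by sliding `b`.
    compatible-τ : ∀ {c d} → c <x d → (τ ⟨$⟩ʳ d) <p (τ ⟨$⟩ʳ c) →
                   Compatible τ c d ⊎ (c ≡ a × a <h d) ⊎ Exempt c d
    compatible-τ {c} {d} c<d τd<τc with position c | position d
    ... | at-a refl | at-a refl = contradiction c<d (x.irrefl refl)
    ... | at-a refl | at-b refl rewrite τa | τb = inj₁ (b<ₕa , β<ᶠα)
    ... | at-a refl | at-c d≢a _ eq rewrite τa | eq with h.compare a d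
    ...   | tri< a<ₕd _ _ = inj₂ (inj₁ (refl , a<ₕd))
    ...   | tri≈ _ a≡d _  = contradiction (sym a≡d) d≢a
    ...   | tri> _ _ d<ₕa = inj₁ (d<ₕa , f.trans β<ᶠα (above-α c<d d<ₕa d≢a τd<τc))
    compatible-τ c<d τd<τc | at-b refl | at-a refl = contradiction a<b (x.asym c<d)
    compatible-τ c<d τd<τc | at-b refl | at-b refl = contradiction c<d (x.irrefl refl)
    -- Validity for `b` gives the comparison of heights, validity for `a` the one at `α`.
    compatible-τ c<d τd<τc | at-b refl | at-c _ _ eq rewrite τb | eq =
      inj₁ (proj₁ (valid c<d (p.trans τd<τc α<β)) , proj₂ (valid (x.trans a<b c<d) τd<τc))
    compatible-τ c<d τd<τc | at-c _ _ eq | at-a refl rewrite τa | eq =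
      inj₁ (proj₁ (valid c<d (p.trans α<β τd<τc)) , proj₂ (valid (x.trans c<d a<b) τd<τc))
    compatible-τ {c} c<d τd<τc | at-c _ c≢b eq | at-b refl rewrite τb | eq with h.compare b c
    ...   | tri< b<ₕc _ _ = inj₁ (b<ₕc , f.trans (below-β c<d b<ₕc c≢b τd<τc) β<ᶠα)
    ...   | tri≈ _ b≡c _  = contradiction (sym b≡c) c≢b
    ...   | tri> _ _ c<ₕb = inj₂ (inj₂ (refl , c<ₕb))
    compatible-τ c<d τd<τc | at-c _ _ eqc | at-c _ _ eqd rewrite eqc | eqd = inj₁ (valid c<d τd<τc)

    -- The level of `α` in `<f` separates the positions used by the two slides, so they do not
    -- interfere. The negation in `Zᵈ` admits `α` itself, where `b` starts.
    Z Zᵈ : Pred (Fin n) 0ℓ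
    Z  z = α <p z × z <f α
    Zᵈ z = z <p β × ¬ z <f α

    exempt-below-a : ∀ {c d} → Exempt c d → d <h a
    exempt-below-a (refl , _) = b<ₕa

    module Right = Sliding O μ-decreases a Exempt exempt-below-a Z
    module Left  = Sliding (dual O) μ-decreasesᵈ b (λ _ _ → ⊥) ⊥-elim Zᵈ

    -- Before the exchange `b` occupied `β`, the position of `a` in `τ`; hence `b` is the tenant,
    -- and validity of `σ` at `b` bounds the blocking points.
    right-slidable : Right.Slidable τ b
    right-slidable = record
      { compatible  = compatible-τ
      ; blocking-<t = blocking-<b
      ; tenant      = tenant
      ; blocking∈Z  = blocking∈Z
      ; r∈Z         = subst Z (sym τa) (α<β , β<ᶠα)
      ; Z-below     = Z-below
      }
      where
      blocking-<b : ∀ {c} → Right.Blocking τ c → c <x b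
      blocking-<b {c} (a<c , a<ₕc , τc<τa) with position c
      ... | at-a refl = contradiction a<c (x.irrefl refl)
      ... | at-b refl = contradiction a<ₕc (h.asym b<ₕa)
      ... | at-c _ c≢b eq with x.compare c b
      ...   | tri< c<b _ _ = c<b
      ...   | tri≈ _ c≡b _ = contradiction c≡b c≢b
      ...   | tri> _ _ b<c =
        contradiction (h.trans b<ₕa a<ₕc) (h.asym (proj₁ (valid b<c (subst₂ _<p_ eq τa τc<τa))))

      tenant : ∀ {c} → c <x b → (τ ⟨$⟩ʳ a) <p (τ ⟨$⟩ʳ c) → (τ ⟨$⟩ʳ c) <f (τ ⟨$⟩ʳ a)
      tenant {c} c<b τa<τc with position c
      ... | at-a refl = contradiction τa<τc (p.irrefl refl)
      ... | at-b refl = contradiction c<b (x.irrefl refl)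
      ... | at-c _ _ eq rewrite τa | eq = proj₂ (valid c<b τa<τc)

      blocking∈Z : ∀ {c} → Right.Blocking τ c → Z (τ ⟨$⟩ʳ c)
      blocking∈Z {c} (a<c , a<ₕc , τc<τa) with c<b ← blocking-<b (a<c , a<ₕc , τc<τa) | position c
      ... | at-a refl = contradiction a<c (x.irrefl refl)
      ... | at-b refl = contradiction a<ₕc (h.asym b<ₕa)
      ... | at-c c≢a c≢b eq rewrite τa | eq with p.compare α (σ ⟨$⟩ʳ c)
      ...   | tri< α<σc _ _ = α<σc , f.trans (below-β c<b (h.trans b<ₕa a<ₕc) c≢b α<σc) β<ᶠα
      ...   | tri≈ _ α≡σc _ = contradiction (sym (⟨$⟩ʳ-injective σ α≡σc)) c≢a
      ...   | tri> _ _ σc<α = contradiction a<ₕc (h.asym (proj₁ (valid a<c σc<α)))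

      Z-below : ∀ {c z} → a <x c → c <h a → (τ ⟨$⟩ʳ c) <p (τ ⟨$⟩ʳ a) → Z z → z <f (τ ⟨$⟩ʳ c)
      Z-below {c} a<c c<ₕa τc<τa (_ , z<α) with position c
      ... | at-a refl = contradiction a<c (x.irrefl refl)
      ... | at-b refl rewrite τb = z<α
      ... | at-c c≢a _ eq rewrite τa | eq = f.trans z<α (above-α a<c c<ₕa c≢a τc<τa)

    module AfterRight {ρ} (slid : Right.Slid τ ρ) where

      open Right.Slid slid using (moved)

      ρ-below-a : ∀ {c} → c <h a → ρ ⟨$⟩ʳ c ≡ τ ⟨$⟩ʳ c
      ρ-below-a {c} c<ₕa with moved c
      ... | inj₁ eq        = eq
      ... | inj₂ (c≮a , _) = contradiction c<ₕa c≮a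

      ρb : ρ ⟨$⟩ʳ b ≡ α
      ρb = trans (ρ-below-a b<ₕa) τb

      left-slidable : Left.Slidable ρ a
      left-slidable = record
        { compatible  = compatible
        ; blocking-<t = blocking-<a
        ; tenant      = tenant
        ; blocking∈Z  = blocking∈Z
        ; r∈Z         = subst Zᵈ (sym ρb) (α<β , f.irrefl refl)
        ; Z-below     = Z-below
        }
        where
        compatible : ∀ {c d} → d <x c → (ρ ⟨$⟩ʳ c) <p (ρ ⟨$⟩ʳ d) →
                     Orders.Compatible (dual O) ρ c d ⊎ (c ≡ b × d <h b) ⊎ ⊥
        compatible d<c ρc<ρd with Right.Slid.compatible slid d<c ρc<ρd
        ... | inj₁ (c<ₕd , ρd<ρc) = inj₁ (c<ₕd , ρd<ρc)
        ... | inj₂ exempt         = inj₂ (inj₁ exempt)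

        fixed : ∀ {c} → c <h b → ρ ⟨$⟩ʳ c ≡ σ ⟨$⟩ʳ c × c ≢ a
        fixed {c} c<ₕb with position c
        ... | at-a refl       = contradiction c<ₕb (h.asym b<ₕa)
        ... | at-b refl       = contradiction c<ₕb (h.irrefl refl)
        ... | at-c c≢a _ eq   = trans (ρ-below-a (h.trans c<ₕb b<ₕa)) eq , c≢a

        blocking-<a : ∀ {c} → Left.Blocking ρ c → a <x c
        blocking-<a {c} (c<b , c<ₕb , ρb<ρc) with eq , c≢a ← fixed c<ₕb | x.compare a c
        ... | tri< a<c _ _ = a<c
        ... | tri≈ _ a≡c _ = contradiction (sym a≡c) c≢a
        ... | tri> _ _ c<a = contradiction (h.trans c<ₕb b<ₕa)
                               (h.asym (proj₁ (valid c<a (subst₂ _<p_ ρb eq ρb<ρc))))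

        tenant : ∀ {c} → a <x c → (ρ ⟨$⟩ʳ c) <p (ρ ⟨$⟩ʳ b) → (ρ ⟨$⟩ʳ b) <f (ρ ⟨$⟩ʳ c)
        tenant {c} a<c ρc<ρb rewrite ρb with moved c
        -- The first slide moves points only to positions right of `α`, so a point with image left
        -- of `α` is where `σ` put it.
        ... | inj₂ (_ , α<ρc , _) = contradiction ρc<ρb (p.asym α<ρc)
        ... | inj₁ eq with position c
        ...   | at-a refl = contradiction a<c (x.irrefl refl)
        ...   | at-b refl = contradiction ρc<ρb (p.irrefl ρb)
        ...   | at-c _ _ eq′ rewrite eq | eq′ = proj₂ (valid a<c ρc<ρb)

        blocking∈Z : ∀ {c} → Left.Blocking ρ c → Zᵈ (ρ ⟨$⟩ʳ c)
        blocking∈Z {c} (c<b , c<ₕb , ρb<ρc) with a<c ← blocking-<a (c<b , c<ₕb , ρb<ρc) | eq , _ ← fixed c<ₕb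
          rewrite ρb | eq with p.compare (σ ⟨$⟩ʳ c) β
        ... | tri< σc<β _ _ = σc<β , f.asym (fst-inner a<c (h.trans c<ₕb b<ₕa) ρb<ρc σc<β)
        ... | tri≈ _ σc≡β _ = contradiction (⟨$⟩ʳ-injective σ σc≡β) (λ c≡b → x.irrefl c≡b c<b)
        ... | tri> _ _ β<σc = contradiction c<ₕb (h.asym (proj₁ (valid c<b β<σc)))

        -- A point moved by the first slide lands in `Z`; for any other point, innermostness and
        -- validity of `σ` still apply.
        ρc<α : ∀ {c} → c <x b → b <h c → α <p (ρ ⟨$⟩ʳ c) → (ρ ⟨$⟩ʳ c) <f α
        ρc<α {c} c<b b<ₕc α<ρc with moved c
        ... | inj₂ (_ , _ , ρc<α) = ρc<α
        ... | inj₁ eq with position c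
        ...   | at-a refl rewrite eq | τa = β<ᶠα
        ...   | at-b refl = contradiction c<b (x.irrefl refl)
        ...   | at-c _ c≢b eq′ rewrite eq | eq′ = f.trans (below-β c<b b<ₕc c≢b α<ρc) β<ᶠα

        Z-below : ∀ {c z} → c <x b → b <h c → (ρ ⟨$⟩ʳ b) <p (ρ ⟨$⟩ʳ c) → Zᵈ z → (ρ ⟨$⟩ʳ c) <f z
        Z-below {c} {z} c<b b<ₕc ρb<ρc (_ , z≮α)
          with lt ← ρc<α c<b b<ₕc (subst (_<p (ρ ⟨$⟩ʳ c)) ρb ρb<ρc) | f.compare z α
        ... | tri< z<α _ _  = contradiction z<α z≮α
        ... | tri≈ _ refl _ = lt
        ... | tri> _ _ α<z  = f.trans lt α<z

    improved : ∃[ ρ ] Valid ρ × μ ρ < μ σ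
    improved with ρ , slid ← Right.slide right-slidable
      with π , slid′ ← Left.slide (AfterRight.left-slidable slid)
      = π
      , (λ c<d πd<πc → [ id , (λ ()) ]′ (Left.Slid.compatible slid′ c<d πd<πc))
      , ≤-<-trans (Left.Slid.μ-≤ slid′) (≤-<-trans (Right.Slid.μ-≤ slid) (μ-decreases σ b<ₕa α<β))

  improve : ∀ {σ} → Valid σ → ∃[ ρ ] Valid ρ × (∀ {a b} → ¬ Bad ρ a b)
  improve {σ} valid = go valid (<-wellFounded (μ σ))
    where
    go : ∀ {σ} → Valid σ → Acc _<_ (μ σ) → ∃[ ρ ] Valid ρ × (∀ {a b} → ¬ Bad ρ a b)
    go {σ} valid (acc rs) with Fin.any? (λ a → Fin.any? (bad? σ a))
    ... | no none  = σ , valid , λ bad → none (_ , _ , bad)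
    ... | yes some with _ , _ , inner ← innermost some
                   with ρ , valid-ρ , μρ<μσ ← Exchange.improved valid inner
                   = go valid-ρ (rs μρ<μσ)

-- Strict decrease of the cost under an exchange.

sum-change-one : (f g : Fin n → ℕ) (i : Fin n) → (∀ {k} → k ≢ i → f k ≡ g k) →
                 sum f + g i ≡ sum g + f i
sum-change-one {suc n} f g i same = begin
  sum f + g i                       ≡⟨ cong (_+ g i) (sum-remove f) ⟩
  f i + sum (removeAt f i) + g i    ≡⟨ cong (λ s → f i + s + g i) (sum-cong-≗ (λ k → same (Fin.punchInᵢ≢i i k))) ⟩
  f i + sum (removeAt g i) + g i    ≡⟨ rearrange (f i) _ (g i) ⟩
  g i + sum (removeAt g i) + f i    ≡⟨ cong (_+ f i) (sum-remove g) ⟨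
  sum g + f i                       ∎
  where
  open ≡-Reasoning
  rearrange : ∀ a s b → a + s + b ≡ b + s + a
  rearrange = solve-∀

-- Passes through `m`, which takes the value of `g` at `i` and those of `f` elsewhere.
sum-change-two : (f g : Fin n → ℕ) {i j : Fin n} → i ≢ j → (∀ {k} → k ≢ i → k ≢ j → f k ≡ g k) →
                 f i + f j < g i + g j → sum f < sum g
sum-change-two f g {i} {j} i≢j same lt =
  +-cancelʳ-< (g i + g j) (sum f) (sum g) $ begin-strict
    sum f + (g i + g j)   ≡⟨ +-assoc (sum f) (g i) (g j) ⟨
    sum f + g i + g j     ≡⟨ cong (λ y → sum f + y + g j) (updateAt-updates i f) ⟨
    sum f + m i + g j     ≡⟨ cong (_+ g j) (sum-change-one f m i (λ k≢i → sym (updateAt-minimal _ i f k≢i))) ⟩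
    sum m + f i + g j     ≡⟨ swap₂₃ (sum m) (f i) (g j) ⟩
    sum m + g j + f i     ≡⟨ cong (_+ f i) (sum-change-one m g j m≡g) ⟩
    sum g + m j + f i     ≡⟨ cong (λ y → sum g + y + f i) (updateAt-minimal _ i f (i≢j ∘ sym)) ⟩
    sum g + f j + f i     ≡⟨ swap₂₃ (sum g) (f j) (f i) ⟩
    sum g + f i + f j     ≡⟨ +-assoc (sum g) (f i) (f j) ⟩
    sum g + (f i + f j)   <⟨ +-monoʳ-< (sum g) lt ⟩
    sum g + (g i + g j)   ∎
  where
  open ≤-Reasoning
  m = updateAt f i (const (g i))
  swap₂₃ : ∀ a b c → a + b + c ≡ a + c + b
  swap₂₃ = solve-∀
  m≡g : ∀ {k} → k ≢ j → m k ≡ g k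
  m≡g {k} k≢j with k Fin.≟ i
  ... | yes refl = updateAt-updates i f
  ... | no  k≢i  = trans (updateAt-minimal _ i f k≢i) (same k≢i k≢j)

rearrangement : ∀ {a b c d} → a < b → c < d → a * d + b * c < a * c + b * d
rearrangement {a} {b} {c} {d} a<b c<d
  with k , refl ← m≤n⇒∃[o]m+o≡n a<b | l , refl ← m≤n⇒∃[o]m+o≡n c<d = begin-strict
    a * (suc c + l) + (suc a + k) * c                        <⟨ m<m+n _ (s≤s z≤n) ⟩
    a * (suc c + l) + (suc a + k) * c + suc k * suc l        ≡⟨ expand a k c l ⟩
    a * c + (suc a + k) * (suc c + l)                        ∎
  where
  open ≤-Reasoning
  expand : ∀ a k c l → a * (suc c + l) + (suc a + k) * c + suc k * suc l ≡
                       a * c + (suc a + k) * (suc c + l)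
  expand = solve-∀

-- The bijection for given `u` and `w`.

module _ {n} (u w : Permutation′ n) where

  u⁻¹ : Permutation′ n
  u⁻¹ = Perm.flip u

  orders : Orders n
  orders = record
    { _<x_ = Fin._<_
    ; _<h_ = Fin._<_ on (u⁻¹ ⟨$⟩ʳ_)
    ; _<p_ = Fin._<_
    ; _<f_ = Fin._<_ on (w ⟨$⟩ʳ_)
    ; x-isSTO = Fin.<-isStrictTotalOrder
    ; h-isSTO = on-isSTO u⁻¹ Fin.<-isStrictTotalOrder
    ; p-isSTO = Fin.<-isStrictTotalOrder
    ; f-isSTO = on-isSTO w Fin.<-isStrictTotalOrder
    }

  open Orders orders using (_<h_; _<p_)

  term : Permutation′ n → Fin n → ℕ
  term σ a = toℕ (u⁻¹ ⟨$⟩ʳ a) * (n ∸ toℕ (σ ⟨$⟩ʳ a))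

  cost : Permutation′ n → ℕ
  cost σ = sum (term σ)

  -- Only the exchange equations for `τ` are assumed, so that either argument of `swap` may be the
  -- lower point, as duality requires.
  cost-< : ∀ σ τ {a b} → τ ⟨$⟩ʳ a ≡ σ ⟨$⟩ʳ b → τ ⟨$⟩ʳ b ≡ σ ⟨$⟩ʳ a →
           (∀ {c} → c ≢ a → c ≢ b → τ ⟨$⟩ʳ c ≡ σ ⟨$⟩ʳ c) →
           a <h b → (σ ⟨$⟩ʳ b) <p (σ ⟨$⟩ʳ a) → cost τ < cost σ
  cost-< σ τ {a} {b} τa τb τc a<ₕb σb<σa =
    sum-change-two (term τ) (term σ) (λ a≡b → <-irrefl (cong (toℕ ∘ (u⁻¹ ⟨$⟩ʳ_)) a≡b) a<ₕb)
      (λ {c} c≢a c≢b → cong (λ q → toℕ (u⁻¹ ⟨$⟩ʳ c) * (n ∸ toℕ q)) (τc c≢a c≢b)) lt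
    where
    lt : term τ a + term τ b < term σ a + term σ b
    lt rewrite τa | τb = rearrangement a<ₕb (∸-monoʳ-< σb<σa (<⇒≤ (Fin.toℕ<n _)))

  cost-decreases : Decreases cost orders
  cost-decreases σ {a} {b} = cost-< σ (swap a b σ) (swap-fst a b σ) (swap-snd a b σ) (swap-other σ)

  cost-decreasesᵈ : Decreases cost (dual orders)
  cost-decreasesᵈ σ {a} {b} =
    cost-< σ (swap a b σ) (swap-snd a b σ) (swap-fst a b σ) (λ c≢b c≢a → swap-other σ c≢a c≢b)

  open Improvement orders cost-decreases cost-decreasesᵈ using (Valid; improve)

  id-valid : Valid Perm.id
  id-valid a<b b<a = contradiction b<a (<-asym a<b)

  -- Validity excludes an order reversal of `σ` on a pair rising in height. On a falling pair,
  -- validity settles the reversed case and the absence of bad pairs the other.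
  placement : ∃[ σ ]
    (∀ {a b} → a Fin.< b → (u⁻¹ ⟨$⟩ʳ a) Fin.< (u⁻¹ ⟨$⟩ʳ b) → (σ ⟨$⟩ʳ a) Fin.< (σ ⟨$⟩ʳ b)) ×
    (∀ {a b} → a Fin.< b → (u⁻¹ ⟨$⟩ʳ b) Fin.< (u⁻¹ ⟨$⟩ʳ a) →
               (w ⟨$⟩ʳ (σ ⟨$⟩ʳ a)) Fin.< (w ⟨$⟩ʳ (σ ⟨$⟩ʳ b)))
  placement with σ , valid , none-bad ← improve {σ = Perm.id} id-valid = σ , mono-p , mono-f
    where
    mono-p : ∀ {a b} → a Fin.< b → (u⁻¹ ⟨$⟩ʳ a) Fin.< (u⁻¹ ⟨$⟩ʳ b) → (σ ⟨$⟩ʳ a) Fin.< (σ ⟨$⟩ʳ b)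
    mono-p {a} {b} a<b a<ₕb with Fin.<-cmp (σ ⟨$⟩ʳ a) (σ ⟨$⟩ʳ b)
    ... | tri< lt _ _ = lt
    ... | tri≈ _ eq _ = contradiction a<b (Fin.<-irrefl (⟨$⟩ʳ-injective σ eq))
    ... | tri> _ _ gt = contradiction (proj₁ (valid a<b gt)) (<-asym a<ₕb)
    mono-f : ∀ {a b} → a Fin.< b → (u⁻¹ ⟨$⟩ʳ b) Fin.< (u⁻¹ ⟨$⟩ʳ a) →
             (w ⟨$⟩ʳ (σ ⟨$⟩ʳ a)) Fin.< (w ⟨$⟩ʳ (σ ⟨$⟩ʳ b))
    mono-f {a} {b} a<b b<ₕa
      with Fin.<-cmp (σ ⟨$⟩ʳ a) (σ ⟨$⟩ʳ b) | Fin.<-cmp (w ⟨$⟩ʳ (σ ⟨$⟩ʳ a)) (w ⟨$⟩ʳ (σ ⟨$⟩ʳ b))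
    ... | _              | tri< lt _ _ = lt
    ... | tri< σa<σb _ _ | tri> _ _ gt = contradiction (a<b , b<ₕa , σa<σb , gt) none-bad
    ... | tri> _ _ σb<σa | _           = proj₂ (valid a<b σb<σa)
    ... | tri≈ _ eq _    | _           = contradiction a<b (Fin.<-irrefl (⟨$⟩ʳ-injective σ eq))
    ... | _              | tri≈ _ eq _ =
      contradiction a<b (Fin.<-irrefl (⟨$⟩ʳ-injective σ (⟨$⟩ʳ-injective w eq)))

-- The factorisation of `w`.

-- For `u = yz` with lengths adding, subadditivity applied to `(xy)z` bounds the length of `xy` from
-- below once that of `z` is cancelled.
∈W/[e,u] : (x u : Permutation′ n) → ℓ (x · u) ≡ ℓ x + ℓ u → (W/ [e, u ]ᴿ) x
∈W/[e,u] x u additive y (z , u≈yz , ℓu≡) = ≤-antisym (ℓ-subadditive x y) $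
  +-cancelʳ-≤ (ℓ z) (ℓ x + ℓ y) (ℓ (x · y)) $ begin
    ℓ x + ℓ y + ℓ z     ≡⟨ +-assoc (ℓ x) (ℓ y) (ℓ z) ⟩
    ℓ x + (ℓ y + ℓ z)   ≡⟨ cong (ℓ x +_) ℓu≡ ⟨
    ℓ x + ℓ u           ≡⟨ additive ⟨
    ℓ (x · u)           ≡⟨ ℓ-cong {v = x · u} {x · y · z} (λ i → cong (x ⟨$⟩ʳ_) (u≈yz i)) ⟩
    ℓ (x · y · z)       ≤⟨ ℓ-subadditive (x · y) z ⟩
    ℓ (x · y) + ℓ z     ∎
  where open ≤-Reasoning

theorem4p5 : ∀ (n : ℕ) (u : Permutation′ n) →
    StrictlySurjective _≈_ (multiplication (W/ [e, u ]ᴿ) [e, u ]ᴿ)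
theorem4p5 n u w with σ , mono-p , mono-f ← placement u w =
  ((x , ∈W/[e,u] x u (ℓ-additive x u x-keeps)) , (y , z , u≈yz , ℓu≡)) , λ i → cong (w ⟨$⟩ʳ_) (inverseʳ σ)
  where
  x y z : Permutation′ n
  x = w · σ
  y = Perm.flip σ
  z = σ · u

  u≈yz : u ≈ y · z
  u≈yz i = sym (inverseˡ σ)

  x-keeps : ∀ {i j} → i Fin.< j → (u ⟨$⟩ʳ j) Fin.< (u ⟨$⟩ʳ i) →
            (x ⟨$⟩ʳ (u ⟨$⟩ʳ j)) Fin.< (x ⟨$⟩ʳ (u ⟨$⟩ʳ i))
  x-keeps i<j uj<ui = mono-f uj<ui (subst₂ Fin._<_ (sym (inverseˡ u)) (sym (inverseˡ u)) i<j)

  y-keeps : ∀ {i j} → i Fin.< j → (z ⟨$⟩ʳ j) Fin.< (z ⟨$⟩ʳ i) →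
            (y ⟨$⟩ʳ (z ⟨$⟩ʳ j)) Fin.< (y ⟨$⟩ʳ (z ⟨$⟩ʳ i))
  -- An inversion of `z` is one of `u`: were `u` increasing on the pair, `mono-p` would make `z`
  -- increasing too.
  y-keeps {i} {j} i<j zj<zi = subst₂ Fin._<_ (u≈yz j) (u≈yz i) uj<ui
    where
    uj<ui : (u ⟨$⟩ʳ j) Fin.< (u ⟨$⟩ʳ i)
    uj<ui with Fin.<-cmp (u ⟨$⟩ʳ j) (u ⟨$⟩ʳ i)
    ... | tri< lt _ _ = lt
    ... | tri≈ _ eq _ = contradiction i<j (Fin.<-irrefl (sym (⟨$⟩ʳ-injective u eq)))
    ... | tri> _ _ gt = contradiction zj<zi
      (<-asym (mono-p gt (subst₂ Fin._<_ (sym (inverseˡ u)) (sym (inverseˡ u)) i<j)))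

  ℓu≡ : ℓ u ≡ ℓ y + ℓ z
  ℓu≡ = trans (ℓ-cong {v = u} {y · z} u≈yz) (ℓ-additive y z y-keeps)
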